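{- Let $d\ge 2$ be an integer. Let $V:(0,1)\to\mathbb{R}^{+}$ be a decreasing function such that $V(\epsilon)\to+\infty$ as $\epsilon\to 0^{+}$. Assume that there exists a decreasing sequence $(e_j)_{j\ge 1}$ in $(0,1)$ with $e_j\to 0$ as $j\to+\infty$ such that $$\sum_{j\ge 1}\frac{e_j^{ -(d-1)}}{V(e_j)}<+\infty .$$ Then there exists (by a deterministic construction) a dense forest in $\mathbb{R}^{d}$ with visibility function $W:(0,1)\to\mathbb{R}^{+}$ given by $W(\epsilon)=V(e_i)$, where $i=i(\epsilon)\ge 1$ is the unique index such that $e_i\le\epsilon<e_{i-1}$ (with the convention $e_0=1$).
   Context: $\mathbb{R}^{+}$ denotes the positive reals; "decreasing" means non-increasing. $B_2(0,T)$ is the Euclidean ball of radius $T$ centred at the origin of $\mathbb{R}^d$, and $\mathrm{dist}$ is the Euclidean distance. A subset $Y\subseteq\mathbb{R}^{d}$ has finite density if $\#(B_2(0,T)\cap Y)=O(T^{d})$, i.e. there is $C>0$ with $\#(B_2(0,T)\cap Y)\le C\,T^d$ for every $T>0$. A set $\mathfrak{F}\subseteq\mathbb{R}^{d}$ is a dense forest with visibility function $W$ if $\mathfrak{F}$ has finite density and $W:(0,1)\to\mathbb{R}^{+}$ is a decreasing function tending to $+\infty$ as $\epsilon\to0^{+}$ such that for any $\epsilon\in(0,1)$ and any line segment $L\subseteq\mathbb{R}^{d}$ of length $W(\epsilon)$, there is a point $x\in\mathfrak{F}$ with $\mathrm{dist}(x,L)\le\epsilon$. "Deterministic construction" means that the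 set is specified without any random choice. -}

module Defs where

open import Algebra.Bundles using (CommutativeRing; Semiring)
import Algebra.Definitions.RawSemiring as RawSemiringDefinitions
import Algebra.Properties.Ring as RingProperties
open import Data.Fin.Base using (Fin; zero; suc; toℕ)
import Data.Nat.Base as ℕ
open import Data.Nat.Base using (ℕ; zero; suc)
open import Data.Product.Base using (Σ; Σ-syntax; ∃; _×_; _,_; proj₁; proj₂)
open import Data.Sum.Base using (inj₁; inj₂; [_,_]′)
open import Data.Vec.Functional using (Vector)
import Data.Vec.Functional.Relation.Binary.Equality.Setoid as VecEquality
open import Function.Base using (_∘_; const)
open import Function.Bundles using (Bijection)
open import Level using (0ℓ)
open import Relation.Binary.Bundles using (Setoid)
import Relation.Binary.Construct.NonStrictToStrict as NonStrictToStrict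
import Relation.Binary.Construct.On as On
open import Relation.Binary.Core using (Rel)
open import Relation.Binary.Definitions using (_Respects_)
import Relation.Binary.PropositionalEquality.Properties as ≡
import Relation.Binary.Reasoning.Setoid as SetoidReasoning
open import Relation.Binary.Structures using (IsTotalOrder)
open import Relation.Unary using (Pred; _∈_; _∩_; Satisfiable)

module Bounds {A : Set} (_≤_ : Rel A 0ℓ) where

  UpperBound : Pred A 0ℓ → Pred A 0ℓ
  UpperBound P u = ∀ {x} → x ∈ P → x ≤ u

  LowerBound : Pred A 0ℓ → Pred A 0ℓ
  LowerBound P l = ∀ {x} → x ∈ P → l ≤ x

  Supremum : Pred A 0ℓ → Pred A 0ℓ
  Supremum P s = UpperBound P s × (∀ {u} → UpperBound P u → s ≤ u)

-- ℝ is given by its usual axioms: a totally ordered field in which every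
-- nonempty set that is bounded above has a least upper bound. The value of
-- 0# ⁻¹ is left unspecified.

record CompleteOrderedField : Set₁ where
  infix 9 _⁻¹
  infix 4 _≤_

  field
    commutativeRing : CommutativeRing 0ℓ 0ℓ

  open CommutativeRing commutativeRing public

  field
    _≤_          : Rel Carrier 0ℓ
    isTotalOrder : IsTotalOrder _≈_ _≤_
    +-monoʳ-≤    : ∀ x {y z} → y ≤ z → x + y ≤ x + z
    *-nonneg     : ∀ {x y} → 0# ≤ x → 0# ≤ y → 0# ≤ x * y
    0≉1          : 0# ≉ 1#
    _⁻¹          : Carrier → Carrier
    ⁻¹-cong      : ∀ {x y} → x ≈ y → x ⁻¹ ≈ y ⁻¹
    *-inverseʳ   : ∀ {x} → x ≉ 0# → x * x ⁻¹ ≈ 1#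

  open Bounds _≤_ public

  field
    complete : (P : Pred Carrier 0ℓ) → Satisfiable P →
               Satisfiable (UpperBound P) → ∃ (Supremum P)

  open IsTotalOrder isTotalOrder public
    using (total; antisym)
    renaming (refl to ≤-refl; reflexive to ≤-reflexive; trans to ≤-trans)

  open NonStrictToStrict _≈_ _≤_ public using (_<_)

module RealAnalysis (R : CompleteOrderedField) where

  open CompleteOrderedField R public
    renaming (Carrier to ℝ) hiding (zero)
  open RawSemiringDefinitions (Semiring.rawSemiring semiring) public
    using (_^_; sum) renaming (_×_ to _·_)
  open RingProperties ring using (-‿distribˡ-*; -‿distribʳ-*; -‿involutive)
  open SetoidReasoning setoid

  private
    ≤-respʳ : ∀ {x y z} → y ≈ z → x ≤ y → x ≤ z
    ≤-respʳ y≈z x≤y = ≤-trans x≤y (≤-reflexive y≈z)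

    ≤-respˡ : ∀ {x y z} → x ≈ y → x ≤ z → y ≤ z
    ≤-respˡ x≈y x≤z = ≤-trans (≤-reflexive (sym x≈y)) x≤z

    +-nonneg : ∀ {x y} → 0# ≤ x → 0# ≤ y → 0# ≤ x + y
    +-nonneg {x} 0≤x 0≤y =
      ≤-trans 0≤x (≤-respˡ (+-identityʳ x) (+-monoʳ-≤ x 0≤y))

    x≤0⇒0≤-x : ∀ {x} → x ≤ 0# → 0# ≤ - x
    x≤0⇒0≤-x {x} x≤0 =
      ≤-respʳ (+-identityʳ (- x)) (≤-respˡ (-‿inverseˡ x) (+-monoʳ-≤ (- x) x≤0))

    x≤y⇒0≤y-x : ∀ {x y} → x ≤ y → 0# ≤ y - x
    x≤y⇒0≤y-x {x} {y} x≤y =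
      ≤-respʳ (+-comm (- x) y) (≤-respˡ (-‿inverseˡ x) (+-monoʳ-≤ (- x) x≤y))

    0≤y-x⇒x≤y : ∀ {x y} → 0# ≤ y - x → x ≤ y
    0≤y-x⇒x≤y {x} {y} 0≤y-x =
      ≤-respʳ x+[y-x]≈y (≤-respˡ (+-identityʳ x) (+-monoʳ-≤ x 0≤y-x))
      where
      x+[y-x]≈y : x + (y - x) ≈ y
      x+[y-x]≈y = begin
        x + (y - x)   ≈⟨ +-comm x (y - x) ⟩
        y - x + x     ≈⟨ +-assoc y (- x) x ⟩
        y + (- x + x) ≈⟨ +-congˡ (-‿inverseˡ x) ⟩
        y + 0#        ≈⟨ +-identityʳ y ⟩
        y             ∎

    square-nonneg : ∀ x → 0# ≤ x * x
    square-nonneg x = [ (λ 0≤x → *-nonneg 0≤x 0≤x) , neg ]′ (total 0# x)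
      where
      -x*-x≈x*x : - x * - x ≈ x * x
      -x*-x≈x*x = begin
        - x * - x     ≈⟨ -‿distribˡ-* x (- x) ⟨
        - (x * - x)   ≈⟨ -‿cong (-‿distribʳ-* x x) ⟨
        - (- (x * x)) ≈⟨ -‿involutive (x * x) ⟩
        x * x         ∎

      neg : x ≤ 0# → 0# ≤ x * x
      neg x≤0 = ≤-respʳ -x*-x≈x*x (*-nonneg (x≤0⇒0≤-x x≤0) (x≤0⇒0≤-x x≤0))

    0≤1 : 0# ≤ 1#
    0≤1 = ≤-respʳ (*-identityˡ 1#) (square-nonneg 1#)

    square-≤⇒bounded : ∀ {x r} → 0# ≤ x → r * r ≤ x → r ≤ 1# + x
    square-≤⇒bounded {x} {r} 0≤x r²≤x = [ (λ r≤1+x → r≤1+x) , large ]′ (total r (1# + x))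
      where
      x≤1+x : x ≤ 1# + x
      x≤1+x = ≤-respʳ (+-comm x 1#) (≤-respˡ (+-identityʳ x) (+-monoʳ-≤ x 0≤1))

      1≤1+x : 1# ≤ 1# + x
      1≤1+x = ≤-respˡ (+-identityʳ 1#) (+-monoʳ-≤ 1# 0≤x)

      r[r-1]≈r²-r : r * (r - 1#) ≈ r * r - r
      r[r-1]≈r²-r = begin
        r * (r - 1#)       ≈⟨ distribˡ r r (- 1#) ⟩
        r * r + r * - 1#   ≈⟨ +-congˡ (-‿distribʳ-* r 1#) ⟨
        r * r - r * 1#     ≈⟨ +-congˡ (-‿cong (*-identityʳ r)) ⟩
        r * r - r          ∎

      large : 1# + x ≤ r → r ≤ 1# + x
      large 1+x≤r = ≤-trans r≤r² (≤-trans r²≤x x≤1+x)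
        where
        1≤r : 1# ≤ r
        1≤r = ≤-trans 1≤1+x 1+x≤r

        r≤r² : r ≤ r * r
        r≤r² = 0≤y-x⇒x≤y (≤-respʳ r[r-1]≈r²-r
                 (*-nonneg (≤-trans 0≤1 1≤r) (x≤y⇒0≤y-x 1≤r)))

  supremum : (P : Pred ℝ 0ℓ) → Satisfiable P → Satisfiable (UpperBound P) → ℝ
  supremum P nonempty bounded = proj₁ (complete P nonempty bounded)

  infimum : (P : Pred ℝ 0ℓ) → Satisfiable P → Satisfiable (LowerBound P) → ℝ
  infimum P (x , x∈P) bounded =
    supremum (LowerBound P) bounded (x , λ l≤P → l≤P x∈P)

  √ : (x : ℝ) → 0# ≤ x → ℝ
  √ x 0≤x = supremum (λ r → r * r ≤ x)
    (0# , ≤-respˡ (sym (zeroˡ 0#)) 0≤x)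
    (1# + x , square-≤⇒bounded 0≤x)

  √-nonneg : ∀ x (0≤x : 0# ≤ x) → 0# ≤ √ x 0≤x
  √-nonneg x 0≤x = proj₁ (proj₂ (complete _ _ _)) (≤-respˡ (sym (zeroˡ 0#)) 0≤x)

  ∣_∣ : ℝ → ℝ
  ∣ x ∣ = [ const x , const (- x) ]′ (total 0# x)

  ConvergesTo : (ℕ → ℝ) → ℝ → Set
  ConvergesTo u l =
    ∀ δ → 0# < δ → ∃ λ N → ∀ n → N ℕ.≤ n → ∣ u n - l ∣ < δ

  partialSum : (ℕ → ℝ) → ℕ → ℝ
  partialSum a n = sum {n} (a ∘ toℕ)

  Summable : (ℕ → ℝ) → Set
  Summable a = ∃ (ConvergesTo (partialSum a))

  ℝ⁺ : Set
  ℝ⁺ = Σ[ x ∈ ℝ ] 0# < x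

  OpenUnitInterval : Set
  OpenUnitInterval = Σ[ x ∈ ℝ ] (0# < x × x < 1#)

  -- By antisymmetry a decreasing V automatically respects _≈_.

  Decreasing : (OpenUnitInterval → ℝ⁺) → Set
  Decreasing V = ∀ ε ε′ → proj₁ ε ≤ proj₁ ε′ → proj₁ (V ε′) ≤ proj₁ (V ε)

  TendsTo+∞At0⁺ : (OpenUnitInterval → ℝ⁺) → Set
  TendsTo+∞At0⁺ V =
    ∀ M → ∃ λ δ → 0# < δ × (∀ ε → proj₁ ε < δ → M < proj₁ (V ε))

  DecreasingSequence : (ℕ → OpenUnitInterval) → Set
  DecreasingSequence e = ∀ j → proj₁ (e (suc j)) ≤ proj₁ (e j)

  -- Sequences indexed by j ≥ 1 are stored from 0, so that `e j` stands for
  -- e_{j+1}. In `prependOne e` the indices are the original ones, with e_0 = 1.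

  prependOne : (ℕ → OpenUnitInterval) → ℕ → ℝ
  prependOne e zero    = 1#
  prependOne e (suc j) = proj₁ (e j)

  -- e_i ≤ ε < e_{i-1} for i = k + 1.

  IsIndex : (ℕ → OpenUnitInterval) → OpenUnitInterval → ℕ → Set
  IsIndex e ε k =
    prependOne e (suc k) ≤ proj₁ ε × proj₁ ε < prependOne e k

  open VecEquality setoid public using (_≋_; ≋-setoid)

  Point : ℕ → Set
  Point d = Vector ℝ d

  private
    variable
      d : ℕ

  origin : Point d
  origin = const 0#

  sumOfSquares : Point d → ℝ
  sumOfSquares x = sum (λ i → x i * x i)

  sumOfSquares-nonneg : (x : Point d) → 0# ≤ sumOfSquares x
  sumOfSquares-nonneg {zero}  x = ≤-refl
  sumOfSquares-nonneg {suc d} x =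
    +-nonneg (square-nonneg (x zero)) (sumOfSquares-nonneg (x ∘ suc))

  dist : Point d → Point d → ℝ
  dist {d} x y = √ (sumOfSquares x-y) (sumOfSquares-nonneg x-y)
    where
    x-y : Point d
    x-y i = x i - y i

  distances : Point d → Pred (Point d) 0ℓ → Pred ℝ 0ℓ
  distances x L r = ∃ λ y → y ∈ L × r ≈ dist x y

  distTo : (x : Point d) (L : Pred (Point d) 0ℓ) → Satisfiable L → ℝ
  distTo x L (y , y∈L) = infimum (distances x L)
    (dist x y , y , y∈L , refl)
    (0# , λ (_ , _ , r≈dist) → ≤-respʳ (sym r≈dist) (√-nonneg _ _))

  segment : Point d → Point d → Pred (Point d) 0ℓ
  segment a b x =
    ∃ λ t → 0# ≤ t × t ≤ 1# × (∀ i → x i ≈ (1# - t) * a i + t * b i)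

  segment-nonempty : (a b : Point d) → Satisfiable (segment a b)
  segment-nonempty a b =
    (λ i → (1# - 0#) * a i + 0# * b i) , 0# , ≤-refl , 0≤1 , λ _ → refl

  closedBall : ℝ → Pred (Point d) 0ℓ
  closedBall T x = dist origin x ≤ T

  asSetoid : Pred (Point d) 0ℓ → Setoid 0ℓ 0ℓ
  asSetoid {d} P = On.setoid {B = ∃ P} (≋-setoid d) proj₁

  HasCardinality : Pred (Point d) 0ℓ → ℕ → Set
  HasCardinality P n = Bijection (≡.setoid (Fin n)) (asSetoid P)

  record Subset (d : ℕ) : Set₁ where
    field
      members  : Pred (Point d) 0ℓ
      respects : members Respects _≋_

  open Subset public

  FiniteDensity : Subset d → Set
  FiniteDensity {d} Y =
    ∃ λ C → 0# < C × (∀ T → 0# < T →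
      ∃ λ n → HasCardinality (closedBall T ∩ members Y) n
            × n · 1# ≤ C * T ^ d)

  record IsDenseForest {d : ℕ} (F : Subset d) (W : OpenUnitInterval → ℝ⁺) : Set where
    field
      finiteDensity : FiniteDensity F
      decreasing    : Decreasing W
      tendsTo+∞     : TendsTo+∞At0⁺ W
      visible       : ∀ ε a b → dist a b ≈ proj₁ (W ε) →
                      ∃ λ x → x ∈ members F
                            × distTo x (segment a b) (segment-nonempty a b) ≤ proj₁ ε

{-# OPTIONS --safe #-}
module Submission where

-- For each j take the points of ℝᵈ which, for some i, have i-th coordinate a
-- nonzero multiple of V(e_j) / 4d and all other coordinates nonzero multiples of
-- e_j / 4d. A segment of length V(e_j) moves by at least V(e_j) / 2d in some
-- coordinate i, hence crosses a hyperplane carrying such points, and rounding the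
-- other coordinates of the crossing point displaces it by less than e_j. An
-- interval [-T, T] contains at most 2T / s nonzero multiples of s, so the ball
-- of radius T contains O(e_j^{-(d-1)} / V(e_j)) T^d of these points, which is
-- summable in j.

open import Defs
open import Algebra.Bundles using (Semiring)
import Algebra.Definitions.RawSemiring as RawSemiringDefinitions
import Algebra.Properties.CommutativeSemiring.Exp as ExpProperties
import Algebra.Properties.Monoid.Sum as MonoidSumProperties
import Algebra.Properties.Ring as RingProperties
import Algebra.Properties.Semiring.Mult as SemiringMultProperties
import Algebra.Properties.Semiring.Sum as SemiringSumProperties
import Algebra.Solver.Ring.NaturalCoefficients.Default as SemiringSolver
open import Axiom.ExcludedMiddle using (ExcludedMiddle)
open import Data.Fin.Base as Fin using (Fin; zero; suc; toℕ)
import Data.Fin.Properties as Fin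
open import Data.List.Base as List
  using (List; []; _∷_; _++_; length; upTo; cartesianProductWith; deduplicate)
import Data.List.Membership.Setoid as SetoidMembership
import Data.List.Membership.Setoid.Properties as Membership
import Data.List.Membership.Propositional.Properties as ∈ₚ
import Data.List.Properties as List
open import Data.List.Relation.Unary.All using (_∷_)
open import Data.List.Relation.Unary.AllPairs using (_∷_)
open import Data.List.Relation.Unary.Any as Any using (here; there)
open import Data.List.Relation.Unary.Enumerates.Setoid using (IsEnumeration)
import Data.List.Relation.Unary.Enumerates.Setoid.Properties as Enumerates
open import Data.List.Relation.Unary.Unique.Setoid using (Unique)
import Data.List.Relation.Unary.Unique.DecSetoid.Properties as UniqueDec
open import Data.Nat.Base as ℕ using (ℕ; zero; suc; _∸_)
import Data.Nat.Properties as ℕ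
open import Data.Product using (Σ; ∃; ∃!; _×_; _,_; proj₁; proj₂)
open import Data.Sum.Base as Sum using (_⊎_; inj₁; inj₂; [_,_]′)
open import Data.Vec.Functional as Vector using (Vector; updateAt; replicate)
import Data.Vec.Functional.Properties as Vector
open import Function.Base using (_∘_; const)
open import Function.Bundles using (Bijection)
open import Level using (0ℓ)
open import Relation.Binary.Bundles using (Setoid; DecSetoid; TotalOrder)
open import Relation.Binary.PropositionalEquality.Core as ≡ using (_≡_)
import Relation.Binary.PropositionalEquality.Properties as ≡
import Relation.Binary.Construct.On as On
import Relation.Binary.Properties.TotalOrder as TotalOrderProperties
import Relation.Binary.Reasoning.PartialOrder as ≤-Reasoning
open import Relation.Nullary using (¬_; yes; no; contradiction; decidable-stable)
open import Relation.Unary using (Pred; _⊆_; _∩_)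

-- Lists: lengths of products, and lookup in duplicate-free lists.

length-cartesianProductWith : ∀ {A B C : Set} (f : A → B → C) xs ys →
  length (cartesianProductWith f xs ys) ≡ length xs ℕ.* length ys
length-cartesianProductWith f []       ys = ≡.refl
length-cartesianProductWith f (x ∷ xs) ys = ≡.trans (List.length-++ (List.map (f x) ys))
  (≡.cong₂ ℕ._+_ (List.length-map (f x) ys) (length-cartesianProductWith f xs ys))

module _ (S : Setoid 0ℓ 0ℓ) where
  open Setoid S

  Unique⇒lookup-injective : ∀ {xs} → Unique S xs → ∀ {i j} →
                            List.lookup xs i ≈ List.lookup xs j → i ≡ j
  Unique⇒lookup-injective (x≉ ∷ _) {zero}  {zero}  _  = ≡.refl
  Unique⇒lookup-injective (x≉ ∷ _) {zero}  {suc j} eq =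
    contradiction (Any.map (trans eq) (Membership.∈-lookup S _ j)) (Membership.All[≉]⇒∉ S x≉)
  Unique⇒lookup-injective (x≉ ∷ _) {suc i} {zero}  eq =
    contradiction (Any.map (trans (sym eq)) (Membership.∈-lookup S _ i)) (Membership.All[≉]⇒∉ S x≉)
  Unique⇒lookup-injective (_ ∷ xs!) {suc i} {suc j} eq =
    ≡.cong suc (Unique⇒lookup-injective xs! eq)

-- Excluded middle: descent on the naturals and finite cardinality.

module Classical (em : ExcludedMiddle 0ℓ) where

  -- Walks down from `n` as long as `P` holds, so it ends at 0 or just above a failure of `P`. It
  -- serves as the search for a threshold in `floor` and in `index`.
  jump : (P : ℕ → Set) → ∀ n → P n → P 0 ⊎ ∃ λ m → ¬ P m × P (suc m)
  jump P zero    p = inj₁ p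
  jump P (suc n) p with em {P n}
  ... | yes q = jump P n q
  ... | no ¬q = inj₂ (n , ¬q , p)

  -- Excluded middle decides equality in `S`, so duplicates can be removed from `xs`. Lookup in the
  -- remaining list is then injective, and it is surjective because `xs` enumerates `S`.
  IsEnumeration⇒Bijection : (S : Setoid 0ℓ 0ℓ) → ∀ {xs} → IsEnumeration S xs →
    ∃ λ n → Bijection (≡.setoid (Fin n)) S × n ℕ.≤ length xs
  IsEnumeration⇒Bijection S {xs} enum =
    length ys
    , record
        { to        = List.lookup ys
        ; cong      = λ { ≡.refl → Setoid.refl S }
        ; bijective = Unique⇒lookup-injective S (UniqueDec.deduplicate-! DS xs)
                    , Enumerates.lookup-surjective S (Enumerates.deduplicate⁺ DS enum)
        }
    , List.length-deduplicate (DecSetoid._≟_ DS) xs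
    where
    DS : DecSetoid 0ℓ 0ℓ
    DS = record { isDecEquivalence = record
      { isEquivalence = Setoid.isEquivalence S ; _≟_ = λ _ _ → em } }

    ys : List (Setoid.Carrier S)
    ys = deduplicate (DecSetoid._≟_ DS) xs

  -- A list that covers `P` may contain points outside `P`, whereas enumerating `∃ P` takes elements
  -- of `P`. Each entry is replaced by an equal element of `P` if there is one and dropped
  -- otherwise, so the length does not grow.
  representatives : (S : Setoid 0ℓ 0ℓ) (P : Pred (Setoid.Carrier S) 0ℓ) →
    let open SetoidMembership S using (_∈_)
        open SetoidMembership (On.setoid {B = ∃ P} S proj₁) using () renaming (_∈_ to _∈ₚ_) in
    ∀ xs → ∃ λ ys → length ys ℕ.≤ length xs × (∀ p → proj₁ p ∈ xs → p ∈ₚ ys)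
  representatives S P []       = [] , ℕ.z≤n , λ _ ()
  representatives S P (x ∷ xs)
    with em {∃ λ (p : ∃ P) → Setoid._≈_ S (proj₁ p) x} | representatives S P xs
  ... | yes (q , q≈x) | ys , ∣ys∣≤∣xs∣ , xs⇒ys =
    q ∷ ys , ℕ.s≤s ∣ys∣≤∣xs∣ , λ where
      p (here p≈x)   → here (Setoid.trans S p≈x (Setoid.sym S q≈x))
      p (there p∈xs) → there (xs⇒ys p p∈xs)
  ... | no ¬q         | ys , ∣ys∣≤∣xs∣ , xs⇒ys =
    ys , ℕ.m≤n⇒m≤1+n ∣ys∣≤∣xs∣ , λ where
      p (here p≈x)   → contradiction (p , p≈x) ¬q
      p (there p∈xs) → xs⇒ys p p∈xs

-- Arithmetic of ordered fields.

module OrderedField (em : ExcludedMiddle 0ℓ) (R : CompleteOrderedField) where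
  open Classical em
  open RealAnalysis R
  open RingProperties ring
    using (-‿distribˡ-*; -‿distribʳ-*; -‿involutive; -‿+-comm; -0#≈0#; ⁻¹-anti-homo‿-; xyx⁻¹≈y)
  open SemiringMultProperties semiring using (×-homo-+; ×1-homo-*; ×-congʳ; ×-assoc-*)
  open MonoidSumProperties *-monoid using (sum-replicate)
  open RawSemiringDefinitions (Semiring.rawSemiring semiring) using (product)
  open SemiringSolver commutativeSemiring using (solve; _:+_; _:*_; _:=_; con)

  totalOrder : TotalOrder 0ℓ 0ℓ 0ℓ
  totalOrder = record { isTotalOrder = isTotalOrder }

  open TotalOrder totalOrder public using (poset; ≤-respˡ-≈; ≤-respʳ-≈)
  open TotalOrderProperties totalOrder public
    using (≰⇒>; <⇒≱; <-respʳ-≈; <-respˡ-≈)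
  open ≤-Reasoning poset

  <-≤-trans : ∀ {x y z} → x < y → y ≤ z → x < z
  <-≤-trans {x} {y} {z} x<y y≤z = begin-strict x <⟨ x<y ⟩ y ≤⟨ y≤z ⟩ z ∎

  ≤-<-trans : ∀ {x y z} → x ≤ y → y < z → x < z
  ≤-<-trans {x} {y} {z} x≤y y<z = begin-strict x ≤⟨ x≤y ⟩ y <⟨ y<z ⟩ z ∎

  +-monoˡ-≤ : ∀ x {y z} → y ≤ z → y + x ≤ z + x
  +-monoˡ-≤ x {y} {z} y≤z = begin
    y + x ≈⟨ +-comm y x ⟩
    x + y ≤⟨ +-monoʳ-≤ x y≤z ⟩
    x + z ≈⟨ +-comm x z ⟩
    z + x ∎

  +-mono-≤ : ∀ {x y u v} → x ≤ y → u ≤ v → x + u ≤ y + v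
  +-mono-≤ {y = y} {u = u} x≤y u≤v = ≤-trans (+-monoˡ-≤ u x≤y) (+-monoʳ-≤ y u≤v)

  x≤x+y : ∀ {x y} → 0# ≤ y → x ≤ x + y
  x≤x+y {x} 0≤y = ≤-respˡ-≈ (+-identityʳ x) (+-monoʳ-≤ x 0≤y)

  +-nonneg : ∀ {x y} → 0# ≤ x → 0# ≤ y → 0# ≤ x + y
  +-nonneg 0≤x 0≤y = ≤-trans 0≤x (x≤x+y 0≤y)

  +-pos : ∀ {x y} → 0# < x → 0# ≤ y → 0# < x + y
  +-pos 0<x 0≤y = <-≤-trans 0<x (x≤x+y 0≤y)

  x+[y-x]≈y : ∀ x y → x + (y - x) ≈ y
  x+[y-x]≈y x y = trans (sym (+-assoc x y (- x))) (xyx⁻¹≈y x y)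

  ≤⇒∃+ : ∀ {x y} → x ≤ y → ∃ λ z → 0# ≤ z × y ≈ x + z
  ≤⇒∃+ {x} {y} x≤y =
    y - x , ≤-respˡ-≈ (-‿inverseʳ x) (+-monoˡ-≤ (- x) x≤y) , sym (x+[y-x]≈y x y)

  +-cancelˡ-≤ : ∀ x {y z} → x + y ≤ x + z → y ≤ z
  +-cancelˡ-≤ x {y} {z} x+y≤x+z = begin
    y             ≈⟨ -x+[x+y]≈y y ⟨
    - x + (x + y) ≤⟨ +-monoʳ-≤ (- x) x+y≤x+z ⟩
    - x + (x + z) ≈⟨ -x+[x+y]≈y z ⟩
    z             ∎
    where
    -x+[x+y]≈y : ∀ y → - x + (x + y) ≈ y
    -x+[x+y]≈y y = begin-equality
      - x + (x + y) ≈⟨ +-assoc (- x) x y ⟨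
      - x + x + y   ≈⟨ +-congʳ (-‿inverseˡ x) ⟩
      0# + y        ≈⟨ +-identityˡ y ⟩
      y             ∎

  +-monoʳ-< : ∀ x {y z} → y < z → x + y < x + z
  +-monoʳ-< x y<z = ≰⇒> λ x+z≤x+y → <⇒≱ y<z (+-cancelˡ-≤ x x+z≤x+y)

  x<x+y : ∀ {x y} → 0# < y → x < x + y
  x<x+y {x} 0<y = <-respˡ-≈ (+-identityʳ x) (+-monoʳ-< x 0<y)

  neg-mono-≤ : ∀ {x y} → x ≤ y → - y ≤ - x
  neg-mono-≤ {x} {y} x≤y = begin
    - y             ≈⟨ x+[y-x]≈y (- x) (- y) ⟨
    - x + (- y - - x) ≈⟨ +-congˡ (+-congˡ (-‿involutive x)) ⟩
    - x + (- y + x) ≤⟨ +-monoʳ-≤ (- x) (+-monoʳ-≤ (- y) x≤y) ⟩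
    - x + (- y + y) ≈⟨ +-congˡ (-‿inverseˡ y) ⟩
    - x + 0#        ≈⟨ +-identityʳ (- x) ⟩
    - x             ∎

  *-monoˡ-≤ : ∀ {x} → 0# ≤ x → ∀ {y z} → y ≤ z → x * y ≤ x * z
  *-monoˡ-≤ {x} 0≤x {y} {z} y≤z = let δ , 0≤δ , z≈y+δ = ≤⇒∃+ y≤z in begin
    x * y         ≤⟨ x≤x+y (*-nonneg 0≤x 0≤δ) ⟩
    x * y + x * δ ≈⟨ distribˡ x y δ ⟨
    x * (y + δ)   ≈⟨ *-congˡ z≈y+δ ⟨
    x * z         ∎

  *-monoʳ-≤ : ∀ {x} → 0# ≤ x → ∀ {y z} → y ≤ z → y * x ≤ z * x
  *-monoʳ-≤ {x} 0≤x {y} {z} y≤z = begin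
    y * x ≈⟨ *-comm y x ⟩
    x * y ≤⟨ *-monoˡ-≤ 0≤x y≤z ⟩
    x * z ≈⟨ *-comm x z ⟩
    z * x ∎

  *-mono-≤ : ∀ {x y u v} → 0# ≤ y → 0# ≤ u → x ≤ y → u ≤ v → x * u ≤ y * v
  *-mono-≤ 0≤y 0≤u x≤y u≤v = ≤-trans (*-monoʳ-≤ 0≤u x≤y) (*-monoˡ-≤ 0≤y u≤v)

  [-x]*[-y]≈x*y : ∀ x y → - x * - y ≈ x * y
  [-x]*[-y]≈x*y x y = begin-equality
    - x * - y   ≈⟨ -‿distribˡ-* x (- y) ⟨
    - (x * - y) ≈⟨ -‿cong (-‿distribʳ-* x y) ⟨
    - - (x * y) ≈⟨ -‿involutive (x * y) ⟩
    x * y       ∎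

  square-nonneg : ∀ x → 0# ≤ x * x
  square-nonneg x with total 0# x
  ... | inj₁ 0≤x = *-nonneg 0≤x 0≤x
  ... | inj₂ x≤0 = ≤-respʳ-≈ ([-x]*[-y]≈x*y x x) (*-nonneg 0≤-x 0≤-x)
    where
    0≤-x : 0# ≤ - x
    0≤-x = ≤-respˡ-≈ -0#≈0# (neg-mono-≤ x≤0)

  0<1 : 0# < 1#
  0<1 = ≤-respʳ-≈ (*-identityˡ 1#) (square-nonneg 1#) , 0≉1

  <⇒≉0 : ∀ {x} → 0# < x → x ≉ 0#
  <⇒≉0 (_ , 0≉x) = 0≉x ∘ sym

  ⁻¹-pos : ∀ {x} → 0# < x → 0# < x ⁻¹
  ⁻¹-pos {x} 0<x = ≰⇒> λ x⁻¹≤0 → <⇒≱ 0<1 (begin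
    1#       ≈⟨ *-inverseʳ (<⇒≉0 0<x) ⟨
    x * x ⁻¹ ≤⟨ *-monoˡ-≤ (proj₁ 0<x) x⁻¹≤0 ⟩
    x * 0#   ≈⟨ zeroʳ x ⟩
    0#       ∎)

  *-monoʳ-< : ∀ {x} → 0# < x → ∀ {y z} → y < z → y * x < z * x
  *-monoʳ-< {x} 0<x {y} {z} y<z = ≰⇒> λ zx≤yx → <⇒≱ y<z (begin
    z              ≈⟨ x*[y*y⁻¹]≈x z ⟨
    z * (x * x ⁻¹) ≈⟨ *-assoc z x (x ⁻¹) ⟨
    z * x * x ⁻¹   ≤⟨ *-monoʳ-≤ (proj₁ (⁻¹-pos 0<x)) zx≤yx ⟩
    y * x * x ⁻¹   ≈⟨ *-assoc y x (x ⁻¹) ⟩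
    y * (x * x ⁻¹) ≈⟨ x*[y*y⁻¹]≈x y ⟩
    y              ∎)
    where
    x*[y*y⁻¹]≈x : ∀ y → y * (x * x ⁻¹) ≈ y
    x*[y*y⁻¹]≈x y = trans (*-congˡ (*-inverseʳ (<⇒≉0 0<x))) (*-identityʳ y)

  *-pos : ∀ {x y} → 0# < x → 0# < y → 0# < x * y
  *-pos {x} {y} 0<x 0<y = <-respˡ-≈ (zeroˡ y) (*-monoʳ-< 0<y 0<x)

  square-cancel-≤ : ∀ {x y} → 0# ≤ y → x * x ≤ y * y → x ≤ y
  square-cancel-≤ {x} {y} 0≤y x²≤y² = decidable-stable em λ x≰y →
    let y<x = ≰⇒> x≰y in
    <⇒≱ (*-monoʳ-< (≤-<-trans 0≤y y<x) y<x) (≤-trans x²≤y² (*-monoˡ-≤ 0≤y (proj₁ y<x)))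

  ^-pos : ∀ {x} → 0# < x → ∀ n → 0# < x ^ n
  ^-pos 0<x zero    = 0<1
  ^-pos 0<x (suc n) = *-pos 0<x (^-pos 0<x n)

  ·-nonneg : ∀ n {x} → 0# ≤ x → 0# ≤ n · x
  ·-nonneg zero    0≤x = ≤-refl
  ·-nonneg (suc n) 0≤x = +-nonneg 0≤x (·-nonneg n 0≤x)

  ·-monoˡ-≤ : ∀ {m n x} → 0# ≤ x → m ℕ.≤ n → m · x ≤ n · x
  ·-monoˡ-≤ {n = n} 0≤x ℕ.z≤n       = ·-nonneg n 0≤x
  ·-monoˡ-≤         0≤x (ℕ.s≤s m≤n) = +-monoʳ-≤ _ (·-monoˡ-≤ 0≤x m≤n)

  n·x≈[n·1]*x : ∀ n x → n · x ≈ (n · 1#) * x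
  n·x≈[n·1]*x n x = begin-equality
    n · x         ≈⟨ ×-congʳ n (*-identityˡ x) ⟨
    n · (1# * x)  ≈⟨ ×-assoc-* n 1# x ⟨
    (n · 1#) * x  ∎

  -- Absolute value, square roots and distance to a segment.

  x≤∣x∣ : ∀ x → x ≤ ∣ x ∣
  x≤∣x∣ x with total 0# x
  ... | inj₁ 0≤x = ≤-refl
  ... | inj₂ x≤0 = ≤-trans x≤0 (≤-respˡ-≈ -0#≈0# (neg-mono-≤ x≤0))

  -- The upper-bound half of the supremum defining `√`. It turns a bound on a distance into bounds
  -- on coordinates; `√-least` goes the other way.
  √-upper : ∀ {x r} (0≤x : 0# ≤ x) → r * r ≤ x → r ≤ √ x 0≤x
  √-upper 0≤x = proj₁ (proj₂ (complete _ _ _))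

  √-least : ∀ {x u} (0≤x : 0# ≤ x) → 0# ≤ u → x ≤ u * u → √ x 0≤x ≤ u
  √-least 0≤x 0≤u x≤u² = proj₂ (proj₂ (complete _ _ _))
    λ r²≤x → square-cancel-≤ 0≤u (≤-trans r²≤x x≤u²)

  -- `distTo` is the supremum of the lower bounds of all distances from `x` to the segment, and the
  -- right-hand side is one of these distances.
  distTo-segment-≤ : ∀ {d} {x a b : Point d} {t} → 0# ≤ t → t ≤ 1# →
    distTo x (segment a b) (segment-nonempty a b) ≤ dist x (λ k → (1# - t) * a k + t * b k)
  distTo-segment-≤ 0≤t t≤1 = proj₂ (proj₂ (complete _ _ _))
    λ l≤ → l≤ (_ , (_ , 0≤t , t≤1 , λ k → refl) , refl)

  -- Archimedean property, rounding to multiples, and crossing points.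

  archimedean : ∀ {s} → 0# < s → ∀ x → ∃ λ n → x ≤ n · s
  archimedean {s} 0<s x with em {∃ λ n → x ≤ n · s}
  ... | yes x≤ns = x≤ns
  ... | no  x≰ns = contradiction σ≤σ-s (<⇒≱ σ-s<σ)
    where
    Multiple : Pred ℝ 0ℓ
    Multiple y = ∃ λ n → y ≈ n · s

    Multiple-bounded : UpperBound Multiple x
    Multiple-bounded (n , y≈ns) =
      ≤-respˡ-≈ (sym y≈ns) (proj₁ (≰⇒> λ x≤ns → x≰ns (n , x≤ns)))

    sup : ∃ (Supremum Multiple)
    sup = complete Multiple (0# , 0 , refl) (x , Multiple-bounded)

    σ : ℝ
    σ = proj₁ sup

    -- The successor of each multiple is again a multiple and so at most `σ`; hence `σ - s` is
    -- already an upper bound.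
    σ≤σ-s : σ ≤ σ - s
    σ≤σ-s = proj₂ (proj₂ sup) λ { {y} (n , y≈ns) → +-cancelˡ-≤ s (begin
      s + y       ≤⟨ proj₁ (proj₂ sup) (suc n , +-congˡ y≈ns) ⟩
      σ           ≈⟨ x+[y-x]≈y s σ ⟨
      s + (σ - s) ∎) }

    σ-s<σ : σ - s < σ
    σ-s<σ = begin-strict
      σ - s       <⟨ x<x+y 0<s ⟩
      σ - s + s   ≈⟨ +-comm (σ - s) s ⟩
      s + (σ - s) ≈⟨ x+[y-x]≈y s σ ⟩
      σ           ∎

  opaque
    -- The Archimedean property gives some multiple beyond `x`; descending from it with `jump` stops
    -- where `x` is caught between two consecutive multiples.
    floor : ∀ {s x} → 0# < s → 0# ≤ x → ∃ λ n → n · s ≤ x × x < suc n · s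
    floor {s} {x} 0<s 0≤x = from-archimedean (archimedean 0<s x)
      where
      from-archimedean : (∃ λ n → x ≤ n · s) → ∃ λ n → n · s ≤ x × x < suc n · s
      from-archimedean (N , x≤Ns)
        with jump (λ n → x < suc n · s) N (begin-strict
               x         ≤⟨ x≤Ns ⟩
               N · s     <⟨ x<x+y 0<s ⟩
               N · s + s ≈⟨ +-comm (N · s) s ⟩
               s + N · s ∎)
      ... | inj₁ x<s               = 0 , 0≤x , x<s
      ... | inj₂ (m , x≮ms , x<ns) =
        suc m , decidable-stable em (λ ms≰x → x≮ms (≰⇒> ms≰x)) , x<ns

  -- Zero is excluded so that at most 2T / s multiples lie in [-T, T] for every
  -- T > 0, without the additive constant that would spoil the density as T → 0.

  NonzeroMultiple : ℝ → Pred ℝ 0ℓ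
  NonzeroMultiple s x = ∃ λ n → x ≈ suc n · s ⊎ x ≈ - (suc n · s)

  NonzeroMultiple-resp : ∀ {s x y} → x ≈ y → NonzeroMultiple s x → NonzeroMultiple s y
  NonzeroMultiple-resp x≈y (n , x≈±ns) =
    n , Sum.map (trans (sym x≈y)) (trans (sym x≈y)) x≈±ns

  -‿NonzeroMultiple : ∀ {s x} → NonzeroMultiple s x → NonzeroMultiple s (- x)
  -‿NonzeroMultiple (n , inj₁ x≈ns)  = n , inj₂ (-‿cong x≈ns)
  -‿NonzeroMultiple (n , inj₂ x≈-ns) = n , inj₁ (trans (-‿cong x≈-ns) (-‿involutive _))

  opaque
    -- Without zero, the neighbours `- s` and `s` are `s + s` apart, hence the length of the window.
    -- If `0# ≤ x + s`, the first multiple beyond `x + s` is positive and fits. Otherwise reflecting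
    -- the window in the origin leads back to the first case.
    multipleAbove : ∀ {s} → 0# < s → ∀ x →
                    ∃ λ y → NonzeroMultiple s y × x ≤ y × y ≤ x + (s + s)
    multipleAbove {s} 0<s x = [ right x , left ]′ (total 0# (x + s))
      where
      right : ∀ x → 0# ≤ x + s → ∃ λ y → NonzeroMultiple s y × x ≤ y × y ≤ x + (s + s)
      right x 0≤x+s =
        let n , ns≤x+s , x+s<ns+s = floor 0<s 0≤x+s in
        suc n · s , (n , inj₁ refl)
        , (begin
            x          ≤⟨ x≤x+y (proj₁ 0<s) ⟩
            x + s      ≤⟨ proj₁ x+s<ns+s ⟩
            suc n · s  ∎)
        , (begin
            s + n · s    ≤⟨ +-monoʳ-≤ s ns≤x+s ⟩
            s + (x + s)  ≈⟨ solve 2 (λ s x → s :+ (x :+ s) := x :+ (s :+ s)) refl s x ⟩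
            x + (s + s)  ∎)

      left : x + s ≤ 0# → ∃ λ y → NonzeroMultiple s y × x ≤ y × y ≤ x + (s + s)
      left x+s≤0 =
        let y , y∈ , -x-2s≤y , y≤-x = right (- (x + (s + s))) (begin
              0#                  ≈⟨ -0#≈0# ⟨
              - 0#                ≤⟨ neg-mono-≤ x+s≤0 ⟩
              - (x + s)           ≈⟨ -[x+y]+y≈-x (x + s) s ⟨
              - (x + s + s) + s   ≈⟨ +-congʳ (-‿cong (+-assoc x s s)) ⟩
              - (x + (s + s)) + s ∎)
        in - y , -‿NonzeroMultiple y∈
        , (begin
            x                                 ≈⟨ -‿involutive x ⟨
            - - x                             ≈⟨ -‿cong (-[x+y]+y≈-x x (s + s)) ⟨
            - (- (x + (s + s)) + (s + s))     ≤⟨ neg-mono-≤ y≤-x ⟩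
            - y                               ∎)
        , (begin
            - y                 ≤⟨ neg-mono-≤ -x-2s≤y ⟩
            - - (x + (s + s))   ≈⟨ -‿involutive (x + (s + s)) ⟩
            x + (s + s)         ∎)
        where
        -[x+y]+y≈-x : ∀ x y → - (x + y) + y ≈ - x
        -[x+y]+y≈-x x y = begin-equality
          - (x + y) + y   ≈⟨ +-congʳ (-‿+-comm x y) ⟨
          - x + - y + y   ≈⟨ +-assoc (- x) (- y) y ⟩
          - x + (- y + y) ≈⟨ +-congˡ (-‿inverseˡ y) ⟩
          - x + 0#        ≈⟨ +-identityʳ (- x) ⟩
          - x             ∎

  -- With `z = u + p` and `v = u + q` the parameter is `t = p / q`.
  interpolate : ∀ {u v z} → u < v → u ≤ z → z ≤ v →
                ∃ λ t → 0# ≤ t × t ≤ 1# × z ≈ (1# - t) * u + t * v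
  interpolate {u} {v} {z} u<v u≤z z≤v =
    let p , 0≤p , z≈u+p = ≤⇒∃+ u≤z
        q , 0≤q , v≈u+q = ≤⇒∃+ (proj₁ u<v)
        0<q : 0# < q
        0<q = ≰⇒> λ q≤0 → <⇒≱ u<v (begin
          v      ≈⟨ v≈u+q ⟩
          u + q  ≤⟨ +-monoʳ-≤ u q≤0 ⟩
          u + 0# ≈⟨ +-identityʳ u ⟩
          u      ∎)
        w = q ⁻¹
        0≤w = proj₁ (⁻¹-pos 0<q)
        qw≈1 = *-inverseʳ (<⇒≉0 0<q)
    in p * w , *-nonneg 0≤p 0≤w
    , (begin
        p * w ≤⟨ *-monoʳ-≤ 0≤w (+-cancelˡ-≤ u (begin
                   u + p ≈⟨ z≈u+p ⟨
                   z     ≤⟨ z≤v ⟩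
                   v     ≈⟨ v≈u+q ⟩
                   u + q ∎)) ⟩
        q * w ≈⟨ qw≈1 ⟩
        1#    ∎)
    , (begin-equality
        z       ≈⟨ z≈u+p ⟩
        -- The 0 is next expanded to `p * w - p * w` and the last 1 to `q * w`. What remains is an
        -- identity of commutative semirings in which `- (p * w)` is an independent variable `t′`.
        u + p   ≈⟨ solve 2 (λ u p → u :+ p := (con 1 :+ con 0) :* u :+ p :* con 1) refl u p ⟩
        _       ≈⟨ +-cong (*-congʳ (+-congˡ (-‿inverseʳ (p * w)))) (*-congˡ qw≈1) ⟨
        (1# + (p * w - p * w)) * u + p * (q * w)
                ≈⟨ solve 5 (λ u p q w t′ →
                     (con 1 :+ (p :* w :+ t′)) :* u :+ p :* (q :* w) :=
                     (con 1 :+ t′) :* u :+ p :* w :* (u :+ q)) refl u p q w (- (p * w)) ⟩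
        (1# - p * w) * u + p * w * (u + q)
                ≈⟨ +-congˡ (*-congˡ v≈u+q) ⟨
        (1# - p * w) * u + p * w * v ∎)

  opaque
    -- When the ends come in the opposite order, `t` is exchanged with `1# - t`.
    interpolateBetween : ∀ {u v z} → u < v × u ≤ z × z ≤ v ⊎ v < u × v ≤ z × z ≤ u →
                         ∃ λ t → 0# ≤ t × t ≤ 1# × z ≈ (1# - t) * u + t * v
    interpolateBetween (inj₁ (u<v , u≤z , z≤v)) = interpolate u<v u≤z z≤v
    interpolateBetween {u} {v} {z} (inj₂ (v<u , v≤z , z≤u)) =
      let t , 0≤t , t≤1 , z≈ = interpolate v<u v≤z z≤u in
      1# - t
      , proj₁ (proj₂ (≤⇒∃+ t≤1))
      , +-cancelˡ-≤ t (begin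
          t + (1# - t) ≈⟨ x+[y-x]≈y t 1# ⟩
          1#           ≤⟨ x≤x+y 0≤t ⟩
          1# + t       ≈⟨ +-comm 1# t ⟩
          t + 1#       ∎)
      , (begin-equality
          z                                   ≈⟨ z≈ ⟩
          (1# - t) * v + t * u                ≈⟨ +-comm _ _ ⟩
          t * u + (1# - t) * v                ≈⟨ +-congʳ (*-congʳ (x+[y-x]≈y 1# t)) ⟨
          (1# + (t - 1#)) * u + (1# - t) * v  ≈⟨ +-congʳ (*-congʳ (+-congˡ (⁻¹-anti-homo‿- 1# t))) ⟨
          (1# - (1# - t)) * u + (1# - t) * v  ∎)

  opaque
    -- Ends at least `s + s` apart enclose a nonzero multiple of `s`, namely the one that
    -- `multipleAbove` finds from the smaller end; `t` is the parameter at which it is attained.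
    crossing : ∀ {s u v} → 0# < s → u + (s + s) ≤ v ⊎ v + (s + s) ≤ u →
               ∃ λ t → 0# ≤ t × t ≤ 1# × NonzeroMultiple s ((1# - t) * u + t * v)
    crossing {s} {u} {v} 0<s (inj₁ u+2s≤v) =
      let z , sz , u≤z , z≤u+2s = multipleAbove 0<s u
          t , 0≤t , t≤1 , z≈    = interpolateBetween (inj₁
            (<-≤-trans (x<x+y (+-pos 0<s (proj₁ 0<s))) u+2s≤v , u≤z , ≤-trans z≤u+2s u+2s≤v))
      in t , 0≤t , t≤1 , NonzeroMultiple-resp z≈ sz
    crossing {s} {u} {v} 0<s (inj₂ v+2s≤u) =
      let z , sz , v≤z , z≤v+2s = multipleAbove 0<s v
          t , 0≤t , t≤1 , z≈    = interpolateBetween (inj₂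
            (<-≤-trans (x<x+y (+-pos 0<s (proj₁ 0<s))) v+2s≤u , v≤z , ≤-trans z≤v+2s v+2s≤u))
      in t , 0≤t , t≤1 , NonzeroMultiple-resp z≈ sz

  -- Euclidean distance against coordinates.

  square-gap : ∀ {x y r} → x ≤ y → y ≤ x + r →
               (x - y) * (x - y) ≤ r * r × (y - x) * (y - x) ≤ r * r
  square-gap {x} {y} {r} x≤y y≤x+r = ≤-respˡ-≈ (sym [x-y]²≈[y-x]²) [y-x]²≤r² , [y-x]²≤r²
    where
    0≤y-x : 0# ≤ y - x
    0≤y-x = proj₁ (proj₂ (≤⇒∃+ x≤y))

    y-x≤r : y - x ≤ r
    y-x≤r = +-cancelˡ-≤ x (≤-respˡ-≈ (sym (x+[y-x]≈y x y)) y≤x+r)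

    [y-x]²≤r² : (y - x) * (y - x) ≤ r * r
    [y-x]²≤r² = *-mono-≤ (≤-trans 0≤y-x y-x≤r) 0≤y-x y-x≤r y-x≤r

    [x-y]²≈[y-x]² : (x - y) * (x - y) ≈ (y - x) * (y - x)
    [x-y]²≈[y-x]² = begin-equality
      (x - y) * (x - y)         ≈⟨ [-x]*[-y]≈x*y (x - y) (x - y) ⟨
      - (x - y) * - (x - y)     ≈⟨ *-cong (⁻¹-anti-homo‿- x y) (⁻¹-anti-homo‿- x y) ⟩
      (y - x) * (y - x)         ∎

  sumOfSquares-≤ : ∀ {d c} (x : Point d) → (∀ k → x k * x k ≤ c) → sumOfSquares x ≤ d · c
  sumOfSquares-≤ {zero}  x x²≤c = ≤-refl
  sumOfSquares-≤ {suc d} x x²≤c = +-mono-≤ (x²≤c zero) (sumOfSquares-≤ (x ∘ suc) (x²≤c ∘ suc))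

  square≤sumOfSquares : ∀ {d} (x : Point d) k → x k * x k ≤ sumOfSquares x
  square≤sumOfSquares x zero    = x≤x+y (sumOfSquares-nonneg (x ∘ suc))
  square≤sumOfSquares x (suc k) = begin
    x (suc k) * x (suc k)                           ≤⟨ square≤sumOfSquares (x ∘ suc) k ⟩
    sumOfSquares (x ∘ suc)                          ≤⟨ x≤x+y (square-nonneg (x zero)) ⟩
    sumOfSquares (x ∘ suc) + x zero * x zero        ≈⟨ +-comm _ _ ⟩
    x zero * x zero + sumOfSquares (x ∘ suc)        ∎

  -- The constant is `d` and not its square root: a sum of `d` squares, each at most `r * r`, is at
  -- most `d · (r * r)`, which the natural number inequality `d ≤ d * d` brings below the square of
  -- `d · r`.
  dist-≤ : ∀ {d r} → 0# ≤ r → (x y : Point d) →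
           (∀ k → (x k - y k) * (x k - y k) ≤ r * r) → dist x y ≤ d · r
  dist-≤ {d} {r} 0≤r x y gaps = √-least _ (·-nonneg d 0≤r) (begin
    sumOfSquares (λ k → x k - y k)        ≤⟨ sumOfSquares-≤ (λ k → x k - y k) gaps ⟩
    d · (r * r)                           ≤⟨ ·-monoˡ-≤ (square-nonneg r) (m≤m*m d) ⟩
    (d ℕ.* d) · (r * r)                   ≈⟨ n·x≈[n·1]*x (d ℕ.* d) (r * r) ⟩
    ((d ℕ.* d) · 1#) * (r * r)            ≈⟨ *-congʳ (×1-homo-* d d) ⟩
    (d · 1#) * (d · 1#) * (r * r)         ≈⟨ solve 2 (λ n r → n :* n :* (r :* r) := n :* r :* (n :* r))
                                               refl (d · 1#) r ⟩
    ((d · 1#) * r) * ((d · 1#) * r)       ≈⟨ *-cong (n·x≈[n·1]*x d r) (n·x≈[n·1]*x d r) ⟨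
    (d · r) * (d · r)                     ∎)
    where
    m≤m*m : ∀ m → m ℕ.≤ m ℕ.* m
    m≤m*m zero      = ℕ.z≤n
    m≤m*m m@(suc _) = ℕ.m≤m*n m m

  -- The condition that the absolute value is at most `T`, as two inequalities that need no case
  -- split on the sign.
  BoundedBy : ℝ → Pred ℝ 0ℓ
  BoundedBy T x = x ≤ T × - x ≤ T

  -- The squares of `x k` and `- x k` are both a summand of the squared norm, so both numbers belong
  -- to the set whose supremum is `dist origin x`.
  closedBall⇒BoundedBy : ∀ {d T} {x : Point d} → closedBall T x → ∀ k → BoundedBy T (x k)
  closedBall⇒BoundedBy {d} {T} {x} x∈B k =
    ≤-trans (√-upper _ (≤-respˡ-≈ [0-xₖ]²≈xₖ² (square≤sumOfSquares 0-x k))) x∈B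
    , ≤-trans (√-upper _ (≤-respˡ-≈ [0-xₖ]²≈[-xₖ]² (square≤sumOfSquares 0-x k))) x∈B
    where
    0-x : Point d
    0-x k = 0# - x k

    [0-xₖ]²≈[-xₖ]² : (0# - x k) * (0# - x k) ≈ - x k * - x k
    [0-xₖ]²≈[-xₖ]² = *-cong (+-identityˡ _) (+-identityˡ _)

    [0-xₖ]²≈xₖ² : (0# - x k) * (0# - x k) ≈ x k * x k
    [0-xₖ]²≈xₖ² = trans [0-xₖ]²≈[-xₖ]² ([-x]*[-y]≈x*y (x k) (x k))

  opaque
    -- Contrapositive of `dist-≤`: if every coordinate moved by less than `r`, the distance would be
    -- at most `d · r`.
    longCoordinate : ∀ {d r} → 0# ≤ r → (a b : Point d) → d · r < dist a b →
                     ∃ λ i → a i + r ≤ b i ⊎ b i + r ≤ a i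
    longCoordinate {d} {r} 0≤r a b long with em {∃ λ i → a i + r ≤ b i ⊎ b i + r ≤ a i}
    ... | yes p = p
    ... | no ¬p = contradiction (dist-≤ 0≤r a b gap) (<⇒≱ long)
      where
      gap : ∀ k → (a k - b k) * (a k - b k) ≤ r * r
      gap k with total (a k) (b k)
      ... | inj₁ a≤b = proj₁ (square-gap a≤b (proj₁ (≰⇒> λ a+r≤b → ¬p (k , inj₁ a+r≤b))))
      ... | inj₂ b≤a = proj₂ (square-gap b≤a (proj₁ (≰⇒> λ b+r≤a → ¬p (k , inj₂ b+r≤a))))

  -- Bounds from convergent series and sequences.

  partialSum-mono : ∀ {a} → (∀ j → 0# ≤ a j) → ∀ {m n} → m ℕ.≤ n → partialSum a m ≤ partialSum a n
  partialSum-mono         0≤a {n = zero}  ℕ.z≤n       = ≤-refl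
  partialSum-mono         0≤a {n = suc n} ℕ.z≤n       =
    +-nonneg (0≤a 0) (partialSum-mono (0≤a ∘ suc) {n = n} ℕ.z≤n)
  partialSum-mono {a}     0≤a             (ℕ.s≤s m≤n) =
    +-monoʳ-≤ (a 0) (partialSum-mono (0≤a ∘ suc) m≤n)

  opaque
    -- Nonnegative terms make the partial sums increase, so each lies below a later one that is
    -- within 1 of the limit.
    partialSum-bounded : ∀ {a} → (∀ j → 0# ≤ a j) → Summable a →
                         ∃ λ S → 0# < S × (∀ n → partialSum a n < S)
    -- `below 0` proves that the bound is positive, since the empty partial sum is zero.
    partialSum-bounded {a} 0≤a (l , u→l) = l + 1# , below 0 , below
      where
      N : ℕ
      N = proj₁ (u→l 1# 0<1)

      below : ∀ n → partialSum a n < l + 1#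
      below n = ≤-<-trans (partialSum-mono 0≤a (ℕ.m≤m⊔n n N)) (begin-strict
        u                ≈⟨ x+[y-x]≈y l u ⟨
        l + (u - l)      <⟨ +-monoʳ-< l (≤-<-trans (x≤∣x∣ (u - l))
                              (proj₂ (u→l 1# 0<1) (n ℕ.⊔ N) (ℕ.m≤n⊔m n N))) ⟩
        l + 1#           ∎)
        where
        u : ℝ
        u = partialSum a (n ℕ.⊔ N)

  opaque
    ConvergesTo-0⇒< : ∀ {u} → ConvergesTo u 0# → ∀ {δ} → 0# < δ → ∃ λ N → ∀ n → N ℕ.≤ n → u n < δ
    ConvergesTo-0⇒< {u} u→0 {δ} 0<δ = let N , close = u→0 δ 0<δ in N , λ n N≤n → begin-strict
      u n            ≈⟨ trans (+-congˡ -0#≈0#) (+-identityʳ (u n)) ⟨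
      u n - 0#       ≤⟨ x≤∣x∣ (u n - 0#) ⟩
      ∣ u n - 0# ∣   <⟨ close n N≤n ⟩
      δ              ∎

  -- Counting by finite lists.

  module _ (S : Setoid 0ℓ 0ℓ) where
    open SetoidMembership S using (_∈_)

    -- An upper bound on the size of `P` without an exact count: the list may repeat entries and
    -- leave `P`. Unions and products thus reduce to concatenation and cartesian products, and a
    -- real `r` lets the bounds be computed in the field.
    record Cover (P : Pred (Setoid.Carrier S) 0ℓ) (r : ℝ) : Set where
      constructor cover
      field
        list   : List (Setoid.Carrier S)
        covers : ∀ {x} → P x → x ∈ list
        size   : length list · 1# ≤ r

  module _ {S : Setoid 0ℓ 0ℓ} where

    Cover-⊆ : ∀ {P Q r} → P ⊆ Q → Cover S Q r → Cover S P r
    Cover-⊆ P⊆Q (cover xs Q⊆xs ∣xs∣≤r) = cover xs (Q⊆xs ∘ P⊆Q) ∣xs∣≤r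

    Cover-≤ : ∀ {P r s} → r ≤ s → Cover S P r → Cover S P s
    Cover-≤ r≤s (cover xs P⊆xs ∣xs∣≤r) = cover xs P⊆xs (≤-trans ∣xs∣≤r r≤s)

    Cover-⋃ : ∀ {n} {P : Fin n → Pred (Setoid.Carrier S) 0ℓ} {r} →
              (∀ i → Cover S (P i) (r i)) → Cover S (λ x → ∃ λ i → P i x) (sum r)
    Cover-⋃ {zero}          covers = cover [] (λ ()) ≤-refl
    Cover-⋃ {suc n} {P} {r} covers
      with covers zero | Cover-⋃ {P = P ∘ suc} {r = r ∘ suc} (covers ∘ suc)
    ... | cover xs P₀⊆xs ∣xs∣≤r₀ | cover ys P₊⊆ys ∣ys∣≤r₊ =
      cover (xs ++ ys)
        (λ where
          (zero  , p) → Membership.∈-++⁺ˡ S (P₀⊆xs p)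
          (suc i , p) → Membership.∈-++⁺ʳ S xs (P₊⊆ys (i , p)))
        (begin
          length (xs ++ ys) · 1#            ≡⟨ ≡.cong (_· 1#) (List.length-++ xs) ⟩
          (length xs ℕ.+ length ys) · 1#    ≈⟨ ×-homo-+ 1# (length xs) (length ys) ⟩
          length xs · 1# + length ys · 1#   ≤⟨ +-mono-≤ ∣xs∣≤r₀ ∣ys∣≤r₊ ⟩
          r zero + sum (r ∘ suc)            ∎)

  -- Here the exact count is recovered: entries outside `P` are discarded, then duplicates, and both
  -- steps only shorten the list.
  Cover⇒HasCardinality : ∀ {d} {P : Pred (Point d) 0ℓ} {r} → Cover (≋-setoid d) P r →
                         ∃ λ n → HasCardinality P n × n · 1# ≤ r
  Cover⇒HasCardinality {d} {P} (cover xs P⊆xs ∣xs∣≤r) =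
    let ys , ∣ys∣≤∣xs∣ , xs⇒ys = representatives (≋-setoid d) P xs
        n , P↔n , n≤∣ys∣ = IsEnumeration⇒Bijection (asSetoid P) {ys} (λ p → xs⇒ys p (P⊆xs (proj₂ p)))
    in n , P↔n , ≤-trans (·-monoˡ-≤ (proj₁ 0<1) (ℕ.≤-trans n≤∣ys∣ ∣ys∣≤∣xs∣)) ∣xs∣≤r

  Cover-Π : ∀ {d} {Q : Fin d → Pred ℝ 0ℓ} {r} → (∀ k → 0# ≤ r k) →
            (∀ k → Cover setoid (Q k) (r k)) →
            Cover (≋-setoid d) (λ x → ∀ k → Q k (x k)) (product r)
  Cover-Π {zero}          0≤r covers =
    cover (origin ∷ []) (λ _ → here λ ()) (≤-reflexive (+-identityʳ 1#))
  Cover-Π {suc d} {Q} {r} 0≤r covers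
    with covers zero | Cover-Π {Q = Q ∘ suc} (0≤r ∘ suc) (covers ∘ suc)
  ... | cover xs Q₀⊆xs ∣xs∣≤r₀ | cover ys Q₊⊆ys ∣ys∣≤r₊ =
    cover (cartesianProductWith Vector._∷_ xs ys)
      (λ q → Membership.∈-resp-≈ (≋-setoid (suc d)) (λ { zero → refl ; (suc k) → refl })
        (Membership.∈-cartesianProductWith⁺ setoid (≋-setoid d) (≋-setoid (suc d))
          (λ x≈ y≋ → λ { zero → x≈ ; (suc k) → y≋ k }) (Q₀⊆xs (q zero)) (Q₊⊆ys (q ∘ suc))))
      (begin
        length (cartesianProductWith Vector._∷_ xs ys) · 1#
          ≡⟨ ≡.cong (_· 1#) (length-cartesianProductWith Vector._∷_ xs ys) ⟩
        (length xs ℕ.* length ys) · 1#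
          ≈⟨ ×1-homo-* (length xs) (length ys) ⟩
        (length xs · 1#) * (length ys · 1#)
          ≤⟨ *-mono-≤ (0≤r zero) (·-nonneg (length ys) (proj₁ 0<1)) ∣xs∣≤r₀ ∣ys∣≤r₊ ⟩
        r zero * product (r ∘ suc)
          ∎)

  NonzeroMultiple-∩-BoundedBy : ∀ {s T x} → NonzeroMultiple s x → BoundedBy T x →
    ∃ λ n → suc n · s ≤ T × (x ≈ suc n · s ⊎ x ≈ - (suc n · s))
  NonzeroMultiple-∩-BoundedBy (n , inj₁ x≈ns)  (x≤T , _)  = n , ≤-respˡ-≈ x≈ns x≤T , inj₁ x≈ns
  NonzeroMultiple-∩-BoundedBy (n , inj₂ x≈-ns) (_ , -x≤T) =
    n , ≤-respˡ-≈ (trans (-‿cong x≈-ns) (-‿involutive _)) -x≤T , inj₂ x≈-ns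

  opaque
    -- If `n` is the integer part of `T / s`, there are `n` positive and `n` negative multiples, and
    -- `n` is at most `T * w`. The inverse `w` of `s` is an argument so that it can be supplied in
    -- the form `4d * x ⁻¹`.
    Cover-NonzeroMultiple : ∀ {s w T} → 0# < s → s * w ≈ 1# → 0# ≤ w → 0# ≤ T →
      Cover setoid (NonzeroMultiple s ∩ BoundedBy T) ((T + T) * w)
    Cover-NonzeroMultiple {s} {w} {T} 0<s sw≈1 0≤w 0≤T with floor 0<s 0≤T
    ... | n , ns≤T , T<ns+s =
      cover (List.map pos (upTo n) ++ List.map neg (upTo n)) covers (begin
        length (List.map pos (upTo n) ++ List.map neg (upTo n)) · 1#
                        ≡⟨ ≡.cong (_· 1#) length≡n+n ⟩
        (n ℕ.+ n) · 1#  ≈⟨ ×-homo-+ 1# n n ⟩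
        n · 1# + n · 1# ≤⟨ +-mono-≤ n≤Tw n≤Tw ⟩
        T * w + T * w   ≈⟨ distribʳ w T T ⟨
        (T + T) * w     ∎)
      where
      open SetoidMembership setoid using (_∈_)

      pos neg : ℕ → ℝ
      pos m = suc m · s
      neg m = - (suc m · s)

      length≡n+n : length (List.map pos (upTo n) ++ List.map neg (upTo n)) ≡ n ℕ.+ n
      length≡n+n = ≡.trans (List.length-++ (List.map pos (upTo n)))
        (≡.cong₂ ℕ._+_ (≡.trans (List.length-map pos (upTo n)) (List.length-upTo n))
                       (≡.trans (List.length-map neg (upTo n)) (List.length-upTo n)))

      n≤Tw : n · 1# ≤ T * w
      n≤Tw = begin
        n · 1#             ≈⟨ *-identityʳ (n · 1#) ⟨
        (n · 1#) * 1#      ≈⟨ *-congˡ sw≈1 ⟨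
        (n · 1#) * (s * w) ≈⟨ *-assoc (n · 1#) s w ⟨
        (n · 1#) * s * w   ≈⟨ *-congʳ (n·x≈[n·1]*x n s) ⟨
        n · s * w          ≤⟨ *-monoʳ-≤ 0≤w ns≤T ⟩
        T * w              ∎

      ∈-map : ∀ (f : ℕ → ℝ) {m} → suc m · s ≤ T → f m ∈ List.map f (upTo n)
      ∈-map f {m} ms≤T = Membership.∈-map⁺ (≡.setoid ℕ) setoid (λ { ≡.refl → refl })
        (∈ₚ.∈-upTo⁺ (ℕ.≰⇒> λ n≤m → <⇒≱ T<ns+s (≤-trans (·-monoˡ-≤ (proj₁ 0<s) (ℕ.s≤s n≤m)) ms≤T)))

      covers : ∀ {x} → (NonzeroMultiple s ∩ BoundedBy T) x →
               x ∈ List.map pos (upTo n) ++ List.map neg (upTo n)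
      covers (sx , x≤T) with NonzeroMultiple-∩-BoundedBy sx x≤T
      ... | m , ms≤T , inj₁ x≈ms  = Membership.∈-++⁺ˡ setoid
        (Membership.∈-resp-≈ setoid (sym x≈ms) (∈-map pos {m} ms≤T))
      ... | m , ms≤T , inj₂ x≈-ms = Membership.∈-++⁺ʳ setoid (List.map pos (upTo n))
        (Membership.∈-resp-≈ setoid (sym x≈-ms) (∈-map neg {m} ms≤T))

  product-updateAt-replicate : ∀ {A : Set} (f : A → ℝ) n (i : Fin (suc n)) x y →
    product (f ∘ updateAt (replicate (suc n) y) i (const x)) ≈ f x * f y ^ n
  -- `sum-replicate` is taken in the multiplicative monoid, where the iterated operation is the
  -- power.
  product-updateAt-replicate f n       zero    x y = *-congˡ (sum-replicate n)
  product-updateAt-replicate f (suc n) (suc i) x y = begin-equality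
    f y * product (f ∘ updateAt (replicate (suc n) y) i (const x))
                          ≈⟨ *-congˡ (product-updateAt-replicate f n i x y) ⟩
    f y * (f x * f y ^ n) ≈⟨ solve 3 (λ x y p → y :* (x :* p) := x :* (y :* p))
                               refl (f x) (f y) (f y ^ n) ⟩
    f x * (f y * f y ^ n) ∎

-- A single grid: its points in a ball and its visibility.

module Grids (em : ExcludedMiddle 0ℓ) (R : CompleteOrderedField) (n : ℕ) where
  open RealAnalysis R
  open RawSemiringDefinitions (Semiring.rawSemiring semiring) using (product)
  open SemiringSolver commutativeSemiring using (solve; _:+_; _:*_; _:=_)
  open MonoidSumProperties +-monoid using (sum-cong-≋; sum-replicate)
  open SemiringSumProperties semiring using (*-distribˡ-sum)
  open ExpProperties commutativeSemiring using (^-distrib-*; ^-congˡ)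
  open OrderedField em R
  open ≤-Reasoning poset

  d : ℕ
  d = suc n

  -- Rounding to multiples of `x / 4d` costs up to two spacings, that is `x / 2d`, per coordinate.
  -- Over `d` coordinates this adds up to `x / 2`, which leaves the strict inequality that
  -- `longCoordinate` asks for.
  4d : ℝ
  4d = (d · 1# + d · 1#) + (d · 1# + d · 1#)

  0<4d : 0# < 4d
  0<4d = +-pos (+-pos 0<d (proj₁ 0<d)) (+-nonneg (proj₁ 0<d) (proj₁ 0<d))
    where
    0<d : 0# < d · 1#
    0<d = +-pos 0<1 (·-nonneg n (proj₁ 0<1))

  spacing : ℝ⁺ → ℝ
  spacing (x , _) = x * 4d ⁻¹

  spacing-pos : ∀ u → 0# < spacing u
  spacing-pos (x , 0<x) = *-pos 0<x (⁻¹-pos 0<4d)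

  spacing*4d≈x : ∀ u → spacing u * 4d ≈ proj₁ u
  spacing*4d≈x (x , _) = begin-equality
    x * 4d ⁻¹ * 4d    ≈⟨ solve 3 (λ x w y → x :* w :* y := x :* (y :* w)) refl x (4d ⁻¹) 4d ⟩
    x * (4d * 4d ⁻¹)  ≈⟨ *-congˡ (*-inverseʳ (<⇒≉0 0<4d)) ⟩
    x * 1#            ≈⟨ *-identityʳ x ⟩
    x                 ∎

  spacing-inverse : ∀ u → spacing u * (4d * proj₁ u ⁻¹) ≈ 1#
  spacing-inverse u@(x , 0<x) = begin-equality
    spacing u * (4d * x ⁻¹)  ≈⟨ *-assoc _ 4d (x ⁻¹) ⟨
    spacing u * 4d * x ⁻¹    ≈⟨ *-congʳ (spacing*4d≈x u) ⟩
    x * x ⁻¹                 ≈⟨ *-inverseʳ (<⇒≉0 0<x) ⟩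
    1#                       ∎

  2spacing-pos : ∀ u → 0# < spacing u + spacing u
  2spacing-pos u = +-pos (spacing-pos u) (proj₁ (spacing-pos u))

  d·2spacing<x : ∀ u → d · (spacing u + spacing u) < proj₁ u
  d·2spacing<x u@(x , _) = begin-strict
    h       <⟨ x<x+y 0<h ⟩
    h + h   ≈⟨ +-cong (n·x≈[n·1]*x d (s + s)) (n·x≈[n·1]*x d (s + s)) ⟩
    (d · 1#) * (s + s) + (d · 1#) * (s + s)
            ≈⟨ solve 2 (λ d s → d :* (s :+ s) :+ d :* (s :+ s) := s :* ((d :+ d) :+ (d :+ d)))
                 refl (d · 1#) s ⟩
    s * 4d  ≈⟨ spacing*4d≈x u ⟩
    x       ∎
    where
    s h : ℝ
    s = spacing u
    h = d · (s + s)

    0<h : 0# < h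
    0<h = +-pos (2spacing-pos u) (·-nonneg n (proj₁ (2spacing-pos u)))

  Grid : ℝ⁺ → ℝ⁺ → Fin d → Pred (Point d) 0ℓ
  Grid V ε i x = ∀ k → NonzeroMultiple (spacing (updateAt (replicate d ε) i (const V) k)) (x k)

  -- A nonzero multiple of `spacing V` has absolute value at least `spacing V`. Hence a grid with
  -- `V` larger than `T * 4d` misses the ball of radius `T`, so that only finitely many grids meet a
  -- given ball.
  Grid-∩-BoundedBy : ∀ {V ε i T x} → Grid V ε i x → BoundedBy T (x i) → proj₁ V ≤ T * 4d
  Grid-∩-BoundedBy {V} {ε} {i} {T} {x} x∈G xᵢ≤T = begin
    proj₁ V          ≈⟨ spacing*4d≈x V ⟨
    spacing V * 4d   ≤⟨ *-monoʳ-≤ (proj₁ 0<4d) sV≤T ⟩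
    T * 4d           ∎
    where
    sV≤T : spacing V ≤ T
    sV≤T = let m , ms≤T , _ = NonzeroMultiple-∩-BoundedBy
                 (≡.subst (λ u → NonzeroMultiple (spacing u) (x i))
                          (Vector.updateAt-updates i (replicate d ε)) (x∈G i)) xᵢ≤T
           in ≤-trans (x≤x+y (·-nonneg m (proj₁ (spacing-pos V)))) ms≤T

  -- Coordinate `i` contributes the factor `2T * 4d / V` and each of the other `n` coordinates
  -- `2T * 4d / ε`; the bound collects the `d` factors `2T * 4d`.
  Cover-Grid : ∀ V ε i {T} → 0# ≤ T →
    Cover (≋-setoid d) (λ x → Grid V ε i x × (∀ k → BoundedBy T (x k)))
          (((T + T) * 4d) ^ d * ((proj₁ ε ⁻¹) ^ n * proj₁ V ⁻¹))
  Cover-Grid V ε i {T} 0≤T =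
    Cover-≤ (≤-reflexive product≈) (Cover-⊆ (λ {x} (x∈G , x≤T) k → x∈G k , x≤T k)
      (Cover-Π (λ k → *-nonneg 0≤2T (0≤w (scale k))) (λ k →
        Cover-NonzeroMultiple (spacing-pos (scale k)) (spacing-inverse (scale k)) (0≤w (scale k)) 0≤T)))
    where
    scale : Vector ℝ⁺ d
    scale = updateAt (replicate d ε) i (const V)

    0≤2T : 0# ≤ T + T
    0≤2T = +-nonneg 0≤T 0≤T

    0≤w : ∀ u → 0# ≤ 4d * proj₁ u ⁻¹
    0≤w (_ , 0<x) = proj₁ (*-pos 0<4d (⁻¹-pos 0<x))

    c E⁻¹ V⁻¹ : ℝ
    c   = (T + T) * 4d
    E⁻¹ = proj₁ ε ⁻¹
    V⁻¹ = proj₁ V ⁻¹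

    product≈ : product (λ k → (T + T) * (4d * proj₁ (scale k) ⁻¹)) ≈ c ^ d * (E⁻¹ ^ n * V⁻¹)
    product≈ = begin-equality
      product (λ k → (T + T) * (4d * proj₁ (scale k) ⁻¹))
        ≈⟨ product-updateAt-replicate (λ u → (T + T) * (4d * proj₁ u ⁻¹)) n i V ε ⟩
      (T + T) * (4d * V⁻¹) * ((T + T) * (4d * E⁻¹)) ^ n
        ≈⟨ *-cong (sym (*-assoc _ 4d V⁻¹)) (^-congˡ n (sym (*-assoc _ 4d E⁻¹))) ⟩
      c * V⁻¹ * (c * E⁻¹) ^ n
        ≈⟨ *-congˡ (^-distrib-* c E⁻¹ n) ⟩
      c * V⁻¹ * (c ^ n * E⁻¹ ^ n)
        ≈⟨ solve 4 (λ c v p q → c :* v :* (p :* q) := c :* p :* (q :* v)) refl c V⁻¹ (c ^ n) (E⁻¹ ^ n) ⟩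
      c * c ^ n * (E⁻¹ ^ n * V⁻¹)
        ∎

  opaque
    -- Coordinate `i` of `y` is kept, as it already has the required form; the others are rounded up
    -- by at most two spacings of `ε`.
    Grid-near : ∀ V ε i (y : Point d) → NonzeroMultiple (spacing V) (y i) →
                ∃ λ x → Grid V ε i x × dist x y ≤ proj₁ ε
    Grid-near V ε i y yᵢ∈ = proj₁ ∘ nearby , proj₁ ∘ proj₂ ∘ nearby , (begin
      dist (proj₁ ∘ nearby) y  ≤⟨ dist-≤ 0≤r (proj₁ ∘ nearby) y (λ k →
                                    let _ , _ , y≤x , x≤y+r = nearby k in proj₂ (square-gap y≤x x≤y+r)) ⟩
      d · r                    ≤⟨ proj₁ (d·2spacing<x ε) ⟩
      proj₁ ε                  ∎)
      where
      r : ℝ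
      r = spacing ε + spacing ε

      0≤r : 0# ≤ r
      0≤r = proj₁ (2spacing-pos ε)

      Nearby : Fin d → ℝ⁺ → Set
      Nearby k u = ∃ λ z → NonzeroMultiple (spacing u) z × y k ≤ z × z ≤ y k + r

      nearby : ∀ k → Nearby k (updateAt (replicate d ε) i (const V) k)
      nearby k with k Fin.≟ i
      ... | yes ≡.refl = ≡.subst (Nearby i) (≡.sym (Vector.updateAt-updates i (replicate d ε)))
                           (y i , yᵢ∈ , ≤-refl , x≤x+y 0≤r)
      ... | no  k≢i    = ≡.subst (Nearby k) (≡.sym (Vector.updateAt-minimal k i (replicate d ε) k≢i))
                           (multipleAbove (spacing-pos ε) (y k))

  opaque
    -- Some coordinate `i` changes by at least two spacings of `V` along the segment, so by
    -- `crossing` a point of the segment has a nonzero multiple as its coordinate `i`; `Grid-near`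
    -- moves this point into the grid.
    Grid-visible : ∀ V ε a b → dist a b ≈ proj₁ V →
      ∃ λ i → ∃ λ x → Grid V ε i x × distTo x (segment a b) (segment-nonempty a b) ≤ proj₁ ε
    Grid-visible V ε a b ab≈V = proj₁ long , visibleAlong (crossing (spacing-pos V) (proj₂ long))
      where
      long : ∃ λ i → a i + (spacing V + spacing V) ≤ b i ⊎ b i + (spacing V + spacing V) ≤ a i
      long = longCoordinate (proj₁ (2spacing-pos V)) a b (<-respʳ-≈ (sym ab≈V) (d·2spacing<x V))

      visibleAlong : ∀ {i} →
        (∃ λ t → 0# ≤ t × t ≤ 1# × NonzeroMultiple (spacing V) ((1# - t) * a i + t * b i)) →
        ∃ λ x → Grid V ε i x × distTo x (segment a b) (segment-nonempty a b) ≤ proj₁ ε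
      visibleAlong {i} (t , 0≤t , t≤1 , yᵢ∈) = proj₁ near , proj₁ (proj₂ near)
        , ≤-trans (distTo-segment-≤ {x = proj₁ near} {a} {b} 0≤t t≤1) (proj₂ (proj₂ near))
        where
        near : ∃ λ x → Grid V ε i x × dist x (λ k → (1# - t) * a k + t * b k) ≤ proj₁ ε
        near = Grid-near V ε i (λ k → (1# - t) * a k + t * b k) yᵢ∈

  -- The union of all grids and its finite density.

  module Forest (V ε : ℕ → ℝ⁺) where

    -- The summand of the convergent series in the hypothesis, with `n` for `d - 1`. Up to a factor
    -- depending on `T` and `d`, it bounds the number of points of one level in the ball.
    term : ℕ → ℝ
    term j = (proj₁ (ε j) ⁻¹) ^ n * proj₁ (V j) ⁻¹

    0≤term : ∀ j → 0# ≤ term j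
    0≤term j = proj₁ (*-pos (^-pos (⁻¹-pos (proj₂ (ε j))) n) (⁻¹-pos (proj₂ (V j))))

    forest : Subset d
    forest = record
      { members  = λ x → ∃ λ j → ∃ λ i → Grid (V j) (ε j) i x
      ; respects = λ x≋y (j , i , x∈G) → j , i , λ k → NonzeroMultiple-resp (x≋y k) (x∈G k)
      }

    forest-finiteDensity : (∀ M → ∃ λ N → ∀ j → N ℕ.≤ j → M < proj₁ (V j)) →
                           Summable term → FiniteDensity forest
    forest-finiteDensity V→∞ summable
      with S , 0<S , partialSum<S ← partialSum-bounded 0≤term summable
      = D * S , *-pos 0<D 0<S , count
      where
      c D : ℝ
      -- Chosen so that `(T + T) * 4d` equals `c * T`; the factor `d · 1#` in `D` counts the `d`
      -- directions of the grids on each level.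
      c = 4d + 4d
      D = (d · 1#) * c ^ d

      0<D : 0# < D
      0<D = *-pos (+-pos 0<1 (·-nonneg n (proj₁ 0<1))) (^-pos (+-pos 0<4d (proj₁ 0<4d)) d)

      count : ∀ T → 0# < T → ∃ λ N →
              HasCardinality (closedBall T ∩ members forest) N × N · 1# ≤ D * S * T ^ d
      -- From level `N` on, `V` exceeds `T * 4d` and the grids miss the ball. `N` depends on `T`,
      -- but the partial sum up to `N` stays below `S`, which does not.
      count T 0<T@(0≤T , _) with N , V>T ← V→∞ (T * 4d) =
        Cover⇒HasCardinality (Cover-≤ total≤ (Cover-⊆ early
          (Cover-⋃ λ j → Cover-⋃ λ i → Cover-Grid (V (toℕ j)) (ε (toℕ j)) i 0≤T)))
        where
        b : ℝ
        b = ((T + T) * 4d) ^ d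

        early : closedBall T ∩ members forest ⊆
                λ x → ∃ λ (j : Fin N) → ∃ λ i →
                  Grid (V (toℕ j)) (ε (toℕ j)) i x × (∀ k → BoundedBy T (x k))
        early {x} (x∈B , j , i , x∈G) =
          let x≤T = closedBall⇒BoundedBy x∈B
              j<N = ℕ.≰⇒> λ N≤j → <⇒≱ (V>T j N≤j) (Grid-∩-BoundedBy {x = x} x∈G (x≤T i))
          in Fin.fromℕ< j<N
           , ≡.subst (λ j → ∃ λ i → Grid (V j) (ε j) i x × (∀ k → BoundedBy T (x k)))
                     (≡.sym (Fin.toℕ-fromℕ< j<N)) (i , x∈G , x≤T)

        total≤ : sum {N} (λ j → sum {d} (λ i → b * term (toℕ j))) ≤ D * S * T ^ d
        total≤ = begin
          sum {N} (λ j → sum {d} (λ i → b * term (toℕ j)))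
            ≈⟨ sum-cong-≋ {N} (λ j → begin-equality
                 sum {d} (λ i → b * term (toℕ j))  ≈⟨ sum-replicate d ⟩
                 d · (b * term (toℕ j))            ≈⟨ n·x≈[n·1]*x d _ ⟩
                 (d · 1#) * (b * term (toℕ j))     ≈⟨ *-assoc (d · 1#) b _ ⟨
                 (d · 1#) * b * term (toℕ j)       ∎) ⟩
          sum {N} (λ j → (d · 1#) * b * term (toℕ j))
            ≈⟨ *-distribˡ-sum {N} ((d · 1#) * b) (term ∘ toℕ) ⟨
          (d · 1#) * b * partialSum term N
            ≈⟨ *-congʳ (*-congˡ b≈) ⟩
          (d · 1#) * (c ^ d * T ^ d) * partialSum term N
            ≈⟨ solve 4 (λ d c t s → d :* (c :* t) :* s := d :* c :* t :* s)
                 refl (d · 1#) (c ^ d) (T ^ d) (partialSum term N) ⟩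
          D * T ^ d * partialSum term N
            ≤⟨ *-monoˡ-≤ (*-nonneg (proj₁ 0<D) 0≤T^d) (proj₁ (partialSum<S N)) ⟩
          D * T ^ d * S
            ≈⟨ solve 3 (λ d t s → d :* t :* s := d :* s :* t) refl D (T ^ d) S ⟩
          D * S * T ^ d ∎
          where
          0≤T^d : 0# ≤ T ^ d
          0≤T^d = proj₁ (^-pos 0<T d)

          b≈ : b ≈ c ^ d * T ^ d
          b≈ = begin-equality
            ((T + T) * 4d) ^ d ≈⟨ ^-congˡ d (solve 2 (λ t m → (t :+ t) :* m := (m :+ m) :* t)
                                   refl T 4d) ⟩
            (c * T) ^ d        ≈⟨ ^-distrib-* c T d ⟩
            c ^ d * T ^ d      ∎

-- The index of a given precision and the visibility function.

module Visibility (em : ExcludedMiddle 0ℓ) (R : CompleteOrderedField) where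
  open RealAnalysis R
  open OrderedField em R
  open Classical em

  module _ (e : ℕ → OpenUnitInterval) (e↓ : DecreasingSequence e) where

    e-antitone : ∀ {j k} → j ℕ.≤ k → proj₁ (e k) ≤ proj₁ (e j)
    e-antitone {j} j≤k = go (ℕ.≤⇒≤′ j≤k)
      where
      go : ∀ {k} → j ℕ.≤′ k → proj₁ (e k) ≤ proj₁ (e j)
      go (ℕ.≤′-reflexive ≡.refl) = ≤-refl
      go (ℕ.≤′-step j≤k)         = ≤-trans (e↓ _) (go j≤k)

    -- An index in the sense of `IsIndex` is the least `j` with `e j` at most the given number: by
    -- monotonicity every `e j` with `j` below `k` still exceeds it. Uniqueness of the index and
    -- monotonicity of `W` both rest on this.
    prependOne-first : ∀ {k x} → x < prependOne e k → ∀ {j} → proj₁ (e j) ≤ x → k ℕ.≤ j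
    prependOne-first {zero}  x<1  eⱼ≤x = ℕ.z≤n
    prependOne-first {suc k} x<eₖ eⱼ≤x = ℕ.≰⇒> λ j≤k → <⇒≱ (≤-<-trans eⱼ≤x x<eₖ) (e-antitone j≤k)

    index-unique : ∀ {ε j k} → IsIndex e ε j → IsIndex e ε k → j ≡ k
    index-unique (eⱼ≤ε , ε<eⱼ₋₁) (eₖ≤ε , ε<eₖ₋₁) =
      ℕ.≤-antisym (prependOne-first ε<eⱼ₋₁ eₖ≤ε) (prependOne-first ε<eₖ₋₁ eⱼ≤ε)

    -- Since `e` tends to 0, some `e N` is below `ε`, and `jump` descends to a place where this
    -- starts. If the descent reaches 0, the upper inequality is `ε < 1`, by the convention for
    -- `e_0`.
    index : ConvergesTo (proj₁ ∘ e) 0# → ∀ ε → ∃! _≡_ (IsIndex e ε)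
    index e→0 ε@(x , 0<x , x<1)
      with N , e<x ← ConvergesTo-0⇒< e→0 0<x
      with jump (λ j → proj₁ (e j) ≤ x) N (proj₁ (e<x N ℕ.≤-refl))
    ... | inj₁ e₀≤x                = 0     , (e₀≤x , x<1) , index-unique {ε} (e₀≤x , x<1)
    ... | inj₂ (m , eₘ≰x , eₘ₊₁≤x) =
      suc m , (eₘ₊₁≤x , ≰⇒> eₘ≰x) , index-unique {ε} (eₘ₊₁≤x , ≰⇒> eₘ≰x)

    module _ (index : (ε : OpenUnitInterval) → ∃! _≡_ (IsIndex e ε))
             (V : OpenUnitInterval → ℝ⁺) (V↓ : Decreasing V) where

      W : OpenUnitInterval → ℝ⁺
      W ε = V (e (proj₁ (index ε)))

      -- A larger precision has a smaller or equal index, hence a larger or equal term of `e`, at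
      -- which `V` is smaller or equal.
      W-decreasing : Decreasing W
      W-decreasing ε ε′ ε≤ε′ =
        let j , (eⱼ≤ε , _)     , _ = index ε
            k , (_ , ε′<eₖ₋₁) , _ = index ε′
        in V↓ (e j) (e k) (e-antitone (prependOne-first ε′<eₖ₋₁ (≤-trans eⱼ≤ε ε≤ε′)))

      W-tendsTo+∞ : ConvergesTo (proj₁ ∘ e) 0# → TendsTo+∞At0⁺ V → TendsTo+∞At0⁺ W
      W-tendsTo+∞ e→0 V→∞ M =
        let δ , 0<δ , V>M = V→∞ M
            N , e<δ       = ConvergesTo-0⇒< e→0 0<δ
        in proj₁ (e N) , proj₁ (proj₂ (e N)) , λ ε ε<eN →
             let j , (eⱼ≤ε , _) , _ = index ε in
             V>M (e j) (≤-<-trans eⱼ≤ε (≤-<-trans (proj₁ ε<eN) (e<δ N ℕ.≤-refl)))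

-- The dense forest with the prescribed visibility function.

theorem1p0p1 : ExcludedMiddle 0ℓ →
    (R : CompleteOrderedField) →
    let open RealAnalysis R in
    (d : ℕ) → 2 ℕ.≤ d →
    (V : OpenUnitInterval → ℝ⁺) → Decreasing V → TendsTo+∞At0⁺ V →
    (e : ℕ → OpenUnitInterval) → DecreasingSequence e → ConvergesTo (proj₁ ∘ e) 0# →
    Summable (λ j → (proj₁ (e j) ⁻¹) ^ (d ∸ 1) * proj₁ (V (e j)) ⁻¹) →
    Σ ((ε : OpenUnitInterval) → ∃! _≡_ (IsIndex e ε)) λ index →
    Σ (Subset d) λ F → IsDenseForest F (λ ε → V (e (proj₁ (index ε))))
-- With `d` written as `suc n`, the exponent `d ∸ 1` computes to `n`, so `summable` is the
-- summability of `term` itself.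
theorem1p0p1 em R (suc n) _ V V↓ V→∞ e e↓ e→0 summable =
  index e e↓ e→0 , forest , record
    { finiteDensity = forest-finiteDensity V∘e→∞ summable
    ; decreasing    = W-decreasing e e↓ (index e e↓ e→0) V V↓
    ; tendsTo+∞     = W-tendsTo+∞ e e↓ (index e e↓ e→0) V V↓ e→0 V→∞
    ; visible       = λ ε a b ab≈W →
        -- A segment of length `V (e j)` is seen by the grids of level `j` within `e j`, which is at
        -- most `ε` by the choice of the index.
        let j , (eⱼ≤ε , _) , _ = index e e↓ e→0 ε
            i , x , x∈G , xL≤eⱼ = Grid-visible (V (e j)) (e⁺ j) a b ab≈W
        in x , (j , i , x∈G) , ≤-trans xL≤eⱼ eⱼ≤ε
    }
  where
  open RealAnalysis R
  open OrderedField em R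
  open Visibility em R
  open Grids em R n

  e⁺ : ℕ → ℝ⁺
  e⁺ j = proj₁ (e j) , proj₁ (proj₂ (e j))

  open Forest (V ∘ e) e⁺

  V∘e→∞ : ∀ M → ∃ λ N → ∀ j → N ℕ.≤ j → M < proj₁ (V (e j))
  V∘e→∞ M =
    let δ , 0<δ , V>M = V→∞ M
        N , e<δ       = ConvergesTo-0⇒< e→0 0<δ
    in N , λ j N≤j → V>M (e j) (e<δ j N≤j)
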